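{- For every integer $k\ge 4$, $\tilde{r}(P_3,P_3,C_{4k+1}) \le 6k+3$.
   Context: $P_m$ denotes the path and $C_m$ the cycle on $m$ vertices. The three-color online Ramsey game for graphs $G_1,G_2,G_3$ is played by Builder and Painter on an infinite vertex set with initially no edges. In each round Builder draws an edge between two currently nonadjacent vertices, and Painter immediately colors it red, blue or green. Builder wins once the colored graph contains a red copy of $G_1$, a blue copy of $G_2$, or a green copy of $G_3$. The online Ramsey number $\tilde{r}(G_1,G_2,G_3)$ is the minimum number of rounds within which Builder can guarantee a win against every strategy of Painter. -}

module Defs where

open import Data.Nat using (ℕ; zero; suc; _∸_)
open import Data.Fin using (Fin; toℕ)
open import Data.Product using (Σ; ∃; _×_; _,_)
open import Data.Sum using (_⊎_)
open import Data.List using (List; []; _∷_)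
open import Data.List.Membership.Propositional using (_∈_)
open import Relation.Binary.PropositionalEquality using (_≡_)
open import Relation.Nullary using (¬_)
open import Function.Definitions using (Injective)

data Colour : Set where
  red blue green : Colour

Vertex : Set
Vertex = ℕ

-- A coloured edge: two endpoints and a colour (edges are unordered,
-- see `HasEdge`).
ColouredEdge : Set
ColouredEdge = Vertex × Vertex × Colour

State : Set
State = List ColouredEdge

HasEdge : State → Vertex → Vertex → Colour → Set
HasEdge S u v c = ((u , v , c) ∈ S) ⊎ ((v , u , c) ∈ S)

Adjacent : State → Vertex → Vertex → Set
Adjacent S u v = ∃ λ c → HasEdge S u v c

record Graph : Set₁ where
  field
    size : ℕ
    Edge : Fin size → Fin size → Set
open Graph public

Path : ℕ → Graph
Path m = record { size = m ; Edge = λ i j → toℕ j ≡ suc (toℕ i) }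

Cycle : ℕ → Graph
Cycle m = record
  { size = m
  ; Edge = λ i j → (toℕ j ≡ suc (toℕ i)) ⊎ ((toℕ i ≡ m ∸ 1) × (toℕ j ≡ 0)) }

HasMonoCopy : State → Colour → Graph → Set
HasMonoCopy S c G =
  Σ (Fin (size G) → Vertex) λ f →
    Injective _≡_ _≡_ f × (∀ i j → Edge G i j → HasEdge S (f i) (f j) c)

Won : Graph → Graph → Graph → State → Set
Won G₁ G₂ G₃ S = HasMonoCopy S red G₁ ⊎ HasMonoCopy S blue G₂ ⊎ HasMonoCopy S green G₃

-- BuilderWinsWithin G₁ G₂ G₃ n S : from state S, Builder can force a win
-- within at most n further rounds, against every Painter strategy.
data BuilderWinsWithin (G₁ G₂ G₃ : Graph) : ℕ → State → Set where
  done : ∀ {n S} → Won G₁ G₂ G₃ S → BuilderWinsWithin G₁ G₂ G₃ n S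
  move : ∀ {n S} (u v : Vertex) → ¬ (u ≡ v) → ¬ Adjacent S u v →
         (∀ c → BuilderWinsWithin G₁ G₂ G₃ n ((u , v , c) ∷ S)) →
         BuilderWinsWithin G₁ G₂ G₃ (suc n) S

OnlineRamseyAtMost : Graph → Graph → Graph → ℕ → Set
OnlineRamseyAtMost G₁ G₂ G₃ n = BuilderWinsWithin G₁ G₂ G₃ n []

{-# OPTIONS --safe #-}
module Submission where

-- As long as Painter avoids a red and a blue P₃, an edge is forced to be green
-- once its two ends together already meet both red and blue.  Builder grows a
-- green path and compares the number m of vertices still missing from the cycle
-- with the number f of rounds left; red and blue edges between new vertices are
-- paid back by forced edges, at a long-run price of three rounds per two
-- vertices.  The decisive positions are those in which one end of the path meets
-- both colours and the other end at least one: from there a fixed gadget adds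
-- a ≤ 4 vertices in at most 3a/2 rounds and leads back to such a position, and
-- for m ≤ 4 the cycle can be closed with hardly any loss.  Painter can delay such
-- a position only by conceding three vertices for at most four rounds again and
-- again, and for k ≥ 4 the rounds saved in this way pay for closing the cycle
-- from a worse position.  The gadgets are explicit decision trees, whose validity
-- is decided by evaluation.

open import Defs
open import Data.Nat using (ℕ; _≤_; _+_; _*_)
open import Data.Nat using (zero; suc; _<_; _∸_; _⊔_; _%_; z≤n; s≤s; s≤s⁻¹; _≟_; _≤?_; _<?_)
open import Data.Nat.Properties
open import Data.Nat.DivMod using ([m+n]%n≡m%n; [m+kn]%n≡m%n)
open import Data.Nat.Induction using (<-rec)
open import Data.Nat.Solver using (module +-*-Solver)
open import Data.Fin using (Fin; toℕ)
open import Data.Product using (∃; _×_; _,_; proj₁; proj₂)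
open import Data.Product.Properties using (≡-dec)
open import Data.Sum using (_⊎_; inj₁; inj₂; [_,_]′) renaming (map to ⊎-map)
open import Data.Empty using (⊥)
open import Data.Unit using (⊤; tt)
open import Data.List using (List; []; _∷_; _++_; [_]; map; length; lookup)
open import Data.List.Properties using (length-++)
open import Data.List.Relation.Unary.Any as Any using (Any; here; there)
open import Data.List.Relation.Unary.All as All using (All; []; _∷_)
open import Data.List.Membership.Propositional using (_∈_; _∉_)
open import Data.List.Membership.Propositional.Properties using (∈-map⁺; ∈-++⁺ˡ; ∈-++⁺ʳ; ∈-++⁻; ∈-lookup)
open import Function using (id; _∘_)
open import Relation.Binary using (DecidableEquality)
open import Relation.Binary.PropositionalEquality using (_≡_; _≢_; refl; sym; trans; cong; subst; subst₂)
open import Relation.Nullary using (¬_; Dec; yes; no; contradiction)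
open import Relation.Nullary.Decidable using (_×-dec_; _⊎-dec_; ¬?; True; toWitness)

-- Monochromatic copies

path₃ : ∀ {S c x y z} → HasEdge S x y c → HasEdge S y z c →
        x ≢ y → y ≢ z → x ≢ z → HasMonoCopy S c (Path 3)
path₃ {S} {c} {x} {y} {z} xy yz x≢y y≢z x≢z = f , injective , edges
  where
  f : Fin 3 → Vertex
  f Fin.zero = x
  f (Fin.suc Fin.zero) = y
  f (Fin.suc (Fin.suc Fin.zero)) = z

  injective : ∀ {i j} → f i ≡ f j → i ≡ j
  injective {Fin.zero} {Fin.zero} _ = refl
  injective {Fin.zero} {Fin.suc Fin.zero} e = contradiction e x≢y
  injective {Fin.zero} {Fin.suc (Fin.suc Fin.zero)} e = contradiction e x≢z
  injective {Fin.suc Fin.zero} {Fin.zero} e = contradiction (sym e) x≢y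
  injective {Fin.suc Fin.zero} {Fin.suc Fin.zero} _ = refl
  injective {Fin.suc Fin.zero} {Fin.suc (Fin.suc Fin.zero)} e = contradiction e y≢z
  injective {Fin.suc (Fin.suc Fin.zero)} {Fin.zero} e = contradiction (sym e) x≢z
  injective {Fin.suc (Fin.suc Fin.zero)} {Fin.suc Fin.zero} e = contradiction (sym e) y≢z
  injective {Fin.suc (Fin.suc Fin.zero)} {Fin.suc (Fin.suc Fin.zero)} _ = refl

  edges : ∀ i j → toℕ j ≡ suc (toℕ i) → HasEdge S (f i) (f j) c
  edges Fin.zero (Fin.suc Fin.zero) _ = xy
  edges (Fin.suc Fin.zero) (Fin.suc (Fin.suc Fin.zero)) _ = yz
  edges Fin.zero Fin.zero ()
  edges Fin.zero (Fin.suc (Fin.suc Fin.zero)) ()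
  edges (Fin.suc Fin.zero) Fin.zero ()
  edges (Fin.suc Fin.zero) (Fin.suc Fin.zero) ()
  edges (Fin.suc (Fin.suc Fin.zero)) Fin.zero ()
  edges (Fin.suc (Fin.suc Fin.zero)) (Fin.suc Fin.zero) ()
  edges (Fin.suc (Fin.suc Fin.zero)) (Fin.suc (Fin.suc Fin.zero)) ()

HasEdge-sym : ∀ {S x y c} → HasEdge S x y c → HasEdge S y x c
HasEdge-sym (inj₁ e) = inj₂ e
HasEdge-sym (inj₂ e) = inj₁ e

-- The vertex list records the set of vertices only, so that reversing a
-- path leaves the index unchanged.
data GreenPath (S : State) : Vertex → Vertex → List Vertex → Set where
  single : ∀ u → GreenPath S u u (u ∷ [])
  left   : ∀ {x u v vs} → HasEdge S x u green → x ∉ vs →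
           GreenPath S u v vs → GreenPath S x v (x ∷ vs)
  right  : ∀ {u v y vs} → HasEdge S v y green → y ∉ vs →
           GreenPath S u v vs → GreenPath S u y (y ∷ vs)

flip : ∀ {S u v vs} → GreenPath S u v vs → GreenPath S v u vs
flip (single u) = single u
flip (left e x∉ p) = right (HasEdge-sym e) x∉ (flip p)
flip (right e y∉ p) = left (HasEdge-sym e) y∉ (flip p)

weaken : ∀ {S S′ u v vs} → (∀ {x y c} → HasEdge S x y c → HasEdge S′ x y c) →
         GreenPath S u v vs → GreenPath S′ u v vs
weaken g (single u) = single u
weaken g (left e x∉ p) = left (g e) x∉ (weaken g p)
weaken g (right e y∉ p) = right (g e) y∉ (weaken g p)

start∈ : ∀ {S u v vs} → GreenPath S u v vs → u ∈ vs
start∈ (single u) = here refl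
start∈ (left e x∉ p) = here refl
start∈ (right e y∉ p) = there (start∈ p)

end∈ : ∀ {S u v vs} → GreenPath S u v vs → v ∈ vs
end∈ = start∈ ∘ flip

-- Here the list is in path order, so that `lookup` can serve as the embedding of the cycle.
data Chain (S : State) : Vertex → Vertex → List Vertex → Set where
  single : ∀ u → Chain S u u (u ∷ [])
  cons   : ∀ {x u v vs} → HasEdge S x u green → x ∉ vs →
           Chain S u v vs → Chain S x v (x ∷ vs)

snoc : ∀ {S u v y vs} → Chain S u v vs → HasEdge S v y green → y ∉ vs →
       Chain S u y (vs ++ [ y ])
snoc (single u) e y∉ = cons e (λ { (here refl) → y∉ (here refl) }) (single _)
snoc {y = y} (cons {x} {vs = vs} e′ x∉ p) e y∉ = cons e′ x∉′ (snoc p e (y∉ ∘ there))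
  where
  x∉′ : x ∉ vs ++ [ y ]
  x∉′ x∈ with ∈-++⁻ vs x∈
  ... | inj₁ x∈vs = x∉ x∈vs
  ... | inj₂ (here refl) = y∉ (here refl)

-- Vertices added at the right move to the back of the list; the inclusion of vertex sets carries
-- the freshness conditions over to the reordered list.
toChain : ∀ {S u v vs} → GreenPath S u v vs →
          ∃ λ ws → Chain S u v ws × length ws ≡ length vs × (∀ {x} → x ∈ ws → x ∈ vs)
toChain (single u) = _ , single u , refl , λ x∈ → x∈
toChain (left e x∉ p) with toChain p
... | ws , q , len , sub =
  _ , cons e (x∉ ∘ sub) q , cong suc len ,
  λ { (here refl) → here refl ; (there z∈) → there (sub z∈) }
toChain (right {y = y} {vs} e y∉ p) with toChain p
... | ws , q , len , sub = _ , snoc q e (y∉ ∘ sub) , len′ , sub′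
  where
  len′ : length (ws ++ [ y ]) ≡ suc (length vs)
  len′ = trans (length-++ ws) (trans (+-comm (length ws) 1) (cong suc len))

  sub′ : ∀ {x} → x ∈ ws ++ [ y ] → x ∈ y ∷ vs
  sub′ x∈ with ∈-++⁻ ws x∈
  ... | inj₁ x∈ws = there (sub x∈ws)
  ... | inj₂ (here refl) = here refl

chain-injective : ∀ {S u v vs} → Chain S u v vs → ∀ {i j} → lookup vs i ≡ lookup vs j → i ≡ j
chain-injective (single u) {Fin.zero} {Fin.zero} _ = refl
chain-injective (cons e x∉ p) {Fin.zero} {Fin.zero} _ = refl
chain-injective (cons {vs = vs} e x∉ p) {Fin.zero} {Fin.suc j} eq =
  contradiction (subst (_∈ vs) (sym eq) (∈-lookup j)) x∉
chain-injective (cons {vs = vs} e x∉ p) {Fin.suc i} {Fin.zero} eq =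
  contradiction (subst (_∈ vs) eq (∈-lookup i)) x∉
chain-injective (cons e x∉ p) {Fin.suc i} {Fin.suc j} eq = cong Fin.suc (chain-injective p eq)

chain-first : ∀ {S u v vs} → Chain S u v vs → ∀ i → toℕ i ≡ 0 → lookup vs i ≡ u
chain-first (single u) Fin.zero _ = refl
chain-first (cons e x∉ p) Fin.zero _ = refl

chain-last : ∀ {S u v vs} → Chain S u v vs → ∀ i → toℕ i ≡ length vs ∸ 1 → lookup vs i ≡ v
chain-last (single u) Fin.zero _ = refl
chain-last (cons e x∉ (single v)) (Fin.suc Fin.zero) _ = refl
chain-last (cons e x∉ p@(cons _ _ _)) (Fin.suc i) eq = chain-last p i (suc-injective eq)

chain-step : ∀ {S u v vs} → Chain S u v vs →
             ∀ i j → toℕ j ≡ suc (toℕ i) → HasEdge S (lookup vs i) (lookup vs j) green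
chain-step (single u) Fin.zero Fin.zero ()
chain-step {S} (cons e x∉ p) Fin.zero (Fin.suc j) eq =
  subst (λ z → HasEdge S _ z green) (sym (chain-first p j (suc-injective eq))) e
chain-step (cons e x∉ p) (Fin.suc i) (Fin.suc j) eq = chain-step p i j (suc-injective eq)

close-up : ∀ {S u v vs} → GreenPath S u v vs → HasEdge S u v green →
           HasMonoCopy S green (Cycle (length vs))
close-up {S} {u} {v} {vs} p uv with toChain p
... | ws , q , len , _ = subst (λ n → HasMonoCopy S green (Cycle n)) len
  (lookup ws , chain-injective q , edges)
  where
  edges : ∀ i j → Edge (Cycle (length ws)) i j → HasEdge S (lookup ws i) (lookup ws j) green
  edges i j (inj₁ eq) = chain-step q i j eq
  edges i j (inj₂ (i≡ , j≡)) =
    subst₂ (λ x y → HasEdge S x y green) (sym (chain-last q i i≡)) (sym (chain-first q j j≡))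
      (HasEdge-sym uv)

-- Positions and strategy trees

data Hue : Set where
  R B : Hue

colour : Hue → Colour
colour R = red
colour B = blue

-- The colours known to occur at the two ends of the path: none, one colour at
-- the far end, both at the far end, or both there and one at the near end.
data Kind : Set where
  bare full  : Kind
  half ready : Hue → Kind

near far : Kind → List Colour
near bare = []
near full = []
near (half _) = []
near (ready h) = colour h ∷ []
far bare = []
far full = red ∷ blue ∷ []
far (half h) = colour h ∷ []
far (ready _) = red ∷ blue ∷ []

-- A state is an arbitrary list and may contain loops, hence the clause `w ≢ u`.
Meets : State → Vertex → Colour → Set
Meets S u c = ∃ λ w → HasEdge S u w c × w ≢ u

Win : ℕ → ℕ → State → Set
Win ℓ = BuilderWinsWithin (Path 3) (Path 3) (Cycle ℓ)

-- A green path missing m of the ℓ vertices of the desired cycle.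
record Position (ℓ : ℕ) (S : State) (K : Kind) (m : ℕ) : Set where
  field
    {u v}    : Vertex
    {vs}     : List Vertex
    path     : GreenPath S u v vs
    u≢v      : u ≢ v
    near-end : All (Meets S u) (near K)
    far-end  : All (Meets S v) (far K)
    covers   : length vs + m ≡ ℓ

Wins : ℕ → Kind → ℕ → ℕ → Set
Wins ℓ K m f = ∀ {S} → Position ℓ S K m → Win ℓ f S

data Outcome : Set where
  cycle    : Outcome
  position : Kind → Outcome

-- `draw i j` lists Builder's continuations after a red, blue and green reply;
-- `barred` marks a reply completing a red or blue P₃.  A leaf gives the
-- vertices appended to the path at its near and at its far end; `turned` means
-- that the resulting path is to be read backwards.
data Tree : Set where
  draw           : ℕ → ℕ → Tree → Tree → Tree → Tree
  barred         : Tree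
  closed         : List ℕ → List ℕ → Tree
  reached turned : Kind → List ℕ → List ℕ → Tree

forced : ℕ → ℕ → Tree → Tree
forced i j t = draw i j barred barred t

swapHue : Hue → Hue
swapHue R = B
swapHue B = R

swapKind : Kind → Kind
swapKind bare = bare
swapKind full = full
swapKind (half h) = half (swapHue h)
swapKind (ready h) = ready (swapHue h)

-- The colours are exchanged in the tree itself; the result is validated afresh by evaluation.
swap : Tree → Tree
swap (draw i j r b g) = draw i j (swap b) (swap r) (swap g)
swap barred = barred
swap (closed xs ys) = closed xs ys
swap (reached K xs ys) = reached (swapKind K) xs ys
swap (turned K xs ys) = turned (swapKind K) xs ys

end : ℕ → List ℕ → ℕ
end i [] = i
end i (x ∷ xs) = end x xs

mark : List ℕ → List ℕ → List ℕ
mark used [] = used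
mark used (x ∷ xs) = mark (x ∷ used) xs

-- `Accept o a f`: the outcome o is good enough when a vertices have been added
-- to the path and f rounds of the allowance of the tree are left.
record Rule : Set₁ where
  field
    Accept  : Outcome → ℕ → ℕ → Set
    accept? : ∀ o a f → Dec (Accept o a f)

-- The edges drawn while following a tree form a state on labels: 0 and 1 stand
-- for the ends of the given path (with the old colours As and Bs), all other
-- labels for fresh vertices.  Leaves extend a path with end labels p and q on
-- the labels `used`.
record Frame : Set₁ where
  field
    As Bs : List Colour
    p q   : ℕ
    used  : List ℕ
    rule  : Rule
  open Rule rule public

_≟ᶜ_ : DecidableEquality Colour
red ≟ᶜ red = yes refl
red ≟ᶜ blue = no λ ()
red ≟ᶜ green = no λ ()
blue ≟ᶜ red = no λ ()
blue ≟ᶜ blue = yes refl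
blue ≟ᶜ green = no λ ()
green ≟ᶜ red = no λ ()
green ≟ᶜ blue = no λ ()
green ≟ᶜ green = yes refl

_≟ᵉ_ : DecidableEquality ColouredEdge
_≟ᵉ_ = ≡-dec _≟_ (≡-dec _≟_ _≟ᶜ_)

-- Decidable validity of strategy trees

module Validity (F : Frame) where
  open Frame F

  Known : ℕ → Colour → Set
  Known i c = (i ≡ 0 × c ∈ As) ⊎ (i ≡ 1 × c ∈ Bs)

  -- The neighbour showing colour `c` at `i` differs from `j`, so that it completes a P₃ with an
  -- edge of colour `c` from `i` to `j`. With `j` equal to `i` this is the plain condition used at
  -- the ends of a path.
  Touches : ℕ → ℕ → Colour → ColouredEdge → Set
  Touches i j c (x , y , c′) =
    c′ ≡ c × ((x ≡ i × y ≢ i × y ≢ j) ⊎ (y ≡ i × x ≢ i × x ≢ j))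

  Coloured : State → ℕ → ℕ → Colour → Set
  Coloured L i j c = Known i c ⊎ Any (Touches i j c) L

  Avoids : ℕ → ℕ → ColouredEdge → Set
  Avoids i j (x , y , _) = ¬ (x ≡ i × y ≡ j) × ¬ (x ≡ j × y ≡ i)

  -- The list `L` shows only the edges drawn along the tree. The two old ends may already be
  -- adjacent in the given state, so one end of a new edge has to be fresh.
  Drawable : State → ℕ → ℕ → Set
  Drawable L i j = i ≢ j × (2 ≤ i ⊎ 2 ≤ j) × All (Avoids i j) L

  Clash : State → ℕ → ℕ → Colour → Set
  Clash L i j c = Coloured L i j c ⊎ Coloured L j i c

  Extends : State → ℕ → List ℕ → List ℕ → Set
  Extends L i us [] = ⊤
  Extends L i us (x ∷ xs) =
    HasEdge L i x green × 2 ≤ x × x ∉ us × Extends L x (x ∷ us) xs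

  Extends₂ : State → List ℕ → List ℕ → Set
  Extends₂ L xs ys = Extends L p used xs × Extends L q (mark used xs) ys

  Ends : State → Kind → ℕ → ℕ → Set
  Ends L K i j = i ≢ j × All (Coloured L i i) (near K) × All (Coloured L j j) (far K)

  -- A clashing reply loses for Painter at once, whatever the subtree says; `barred`, never valid
  -- itself, is thus admissible only at a clash.
  Valid : Tree → ℕ → State → Set
  Valid (draw i j r b g) zero L = ⊥
  Valid (draw i j r b g) (suc f) L =
    Drawable L i j ×
    (Clash L i j red ⊎ Valid r f ((i , j , red) ∷ L)) ×
    (Clash L i j blue ⊎ Valid b f ((i , j , blue) ∷ L)) ×
    Valid g f ((i , j , green) ∷ L)
  Valid barred f L = ⊥
  Valid (closed xs ys) f L =
    Extends₂ L xs ys × HasEdge L (end p xs) (end q ys) green ×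
    Accept cycle (length xs + length ys) f
  Valid (reached K xs ys) f L =
    Extends₂ L xs ys × Ends L K (end p xs) (end q ys) ×
    Accept (position K) (length xs + length ys) f
  Valid (turned K xs ys) f L =
    Extends₂ L xs ys × Ends L K (end q ys) (end p xs) ×
    Accept (position K) (length xs + length ys) f

  touches? : ∀ i j c e → Dec (Touches i j c e)
  touches? i j c (x , y , c′) =
    (c′ ≟ᶜ c) ×-dec (((x ≟ i) ×-dec (¬? (y ≟ i) ×-dec ¬? (y ≟ j))) ⊎-dec
                     ((y ≟ i) ×-dec (¬? (x ≟ i) ×-dec ¬? (x ≟ j))))

  coloured? : ∀ L i j c → Dec (Coloured L i j c)
  coloured? L i j c =
    (((i ≟ 0) ×-dec Any.any? (c ≟ᶜ_) As) ⊎-dec ((i ≟ 1) ×-dec Any.any? (c ≟ᶜ_) Bs))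
    ⊎-dec Any.any? (touches? i j c) L

  clash? : ∀ L i j c → Dec (Clash L i j c)
  clash? L i j c = coloured? L i j c ⊎-dec coloured? L j i c

  avoids? : ∀ i j e → Dec (Avoids i j e)
  avoids? i j (x , y , _) =
    ¬? ((x ≟ i) ×-dec (y ≟ j)) ×-dec ¬? ((x ≟ j) ×-dec (y ≟ i))

  drawable? : ∀ L i j → Dec (Drawable L i j)
  drawable? L i j =
    ¬? (i ≟ j) ×-dec (((2 ≤? i) ⊎-dec (2 ≤? j)) ×-dec All.all? (avoids? i j) L)

  hasEdge? : ∀ L i j c → Dec (HasEdge L i j c)
  hasEdge? L i j c = Any.any? ((i , j , c) ≟ᵉ_) L ⊎-dec Any.any? ((j , i , c) ≟ᵉ_) L

  extends? : ∀ L i us xs → Dec (Extends L i us xs)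
  extends? L i us [] = yes tt
  extends? L i us (x ∷ xs) =
    hasEdge? L i x green ×-dec
    ((2 ≤? x) ×-dec (¬? (Any.any? (x ≟_) us) ×-dec extends? L x (x ∷ us) xs))

  extends₂? : ∀ L xs ys → Dec (Extends₂ L xs ys)
  extends₂? L xs ys = extends? L p used xs ×-dec extends? L q (mark used xs) ys

  ends? : ∀ L K i j → Dec (Ends L K i j)
  ends? L K i j =
    ¬? (i ≟ j) ×-dec
    (All.all? (coloured? L i i) (near K) ×-dec All.all? (coloured? L j j) (far K))

  valid? : ∀ t f L → Dec (Valid t f L)
  valid? (draw i j r b g) zero L = no λ ()
  valid? (draw i j r b g) (suc f) L =
    drawable? L i j ×-dec
    ((clash? L i j red ⊎-dec valid? r f ((i , j , red) ∷ L)) ×-dec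
    ((clash? L i j blue ⊎-dec valid? b f ((i , j , blue) ∷ L)) ×-dec
    valid? g f ((i , j , green) ∷ L)))
  valid? barred f L = no λ ()
  valid? (closed xs ys) f L =
    extends₂? L xs ys ×-dec
    (hasEdge? L (end p xs) (end q ys) green ×-dec accept? cycle (length xs + length ys) f)
  valid? (reached K xs ys) f L =
    extends₂? L xs ys ×-dec
    (ends? L K (end p xs) (end q ys) ×-dec accept? (position K) (length xs + length ys) f)
  valid? (turned K xs ys) f L =
    extends₂? L xs ys ×-dec
    (ends? L K (end q ys) (end p xs) ×-dec accept? (position K) (length xs + length ys) f)

-- Realising labels by vertices

bound : (xs : List Vertex) → ∃ λ N → All (_< N) xs
bound [] = 0 , []
bound (x ∷ xs) with bound xs
... | N , xs<N =
  suc x ⊔ N , m≤m⊔n (suc x) N ∷ All.map (λ y<N → ≤-trans y<N (m≤n⊔m (suc x) N)) xs<N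

endpoints : State → List Vertex
endpoints [] = []
endpoints ((x , y , _) ∷ S) = x ∷ y ∷ endpoints S

endpoints∈ : ∀ {S x y c} → (x , y , c) ∈ S → x ∈ endpoints S × y ∈ endpoints S
endpoints∈ (here refl) = here refl , there (here refl)
endpoints∈ (there e) with endpoints∈ e
... | x∈ , y∈ = there (there x∈) , there (there y∈)

-- All vertices of the given state lie below `N`, so that the labels from 2 on become fresh
-- vertices.
record Board (S₀ : State) (As Bs : List Colour) : Set where
  field
    {u v N} : ℕ
    u≢v     : u ≢ v
    u<N     : u < N
    v<N     : v < N
    S₀<N    : ∀ {x y c} → HasEdge S₀ x y c → x < N
    u-meets : All (Meets S₀ u) As
    v-meets : All (Meets S₀ v) Bs

  ι : ℕ → Vertex
  ι 0 = u
  ι 1 = v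
  ι (suc (suc i)) = N + i

  N≤ι : ∀ {i} → 2 ≤ i → N ≤ ι i
  N≤ι {suc (suc i)} _ = m≤m+n N i
  N≤ι {1} (s≤s ())

  ι-injective : ∀ {i j} → ι i ≡ ι j → i ≡ j
  ι-injective {0} {0} _ = refl
  ι-injective {0} {1} e = contradiction e u≢v
  ι-injective {0} {suc (suc j)} e = contradiction e (<⇒≢ (<-≤-trans u<N (m≤m+n N j)))
  ι-injective {1} {0} e = contradiction (sym e) u≢v
  ι-injective {1} {1} _ = refl
  ι-injective {1} {suc (suc j)} e = contradiction e (<⇒≢ (<-≤-trans v<N (m≤m+n N j)))
  ι-injective {suc (suc i)} {0} e = contradiction (sym e) (<⇒≢ (<-≤-trans u<N (m≤m+n N i)))
  ι-injective {suc (suc i)} {1} e = contradiction (sym e) (<⇒≢ (<-≤-trans v<N (m≤m+n N i)))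
  ι-injective {suc (suc i)} {suc (suc j)} e = cong (suc ∘ suc) (+-cancelˡ-≡ N i j e)

Reaches : ℕ → ℕ → Outcome → ℕ → ℕ → Set
Reaches ℓ m cycle a f = a ≡ m
Reaches ℓ m (position K) a f = ∃ λ m′ → m ≡ a + m′ × Wins ℓ K m′ f

-- Soundness of valid trees

module Soundness
  (ℓ : ℕ) (F : Frame) {S₀ : State} (board : Board S₀ (Frame.As F) (Frame.Bs F))
  {vs₀ : List Vertex}
  (path₀ : GreenPath S₀ (Board.ι board (Frame.p F)) (Board.ι board (Frame.q F)) vs₀)
  (unused : ∀ {x} → 2 ≤ x → x ∉ Frame.used F → Board.ι board x ∉ vs₀)
  {m : ℕ} (covers₀ : length vs₀ + m ≡ ℓ)
  where
  open Frame F
  open Validity F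
  open Board board

  embed : ColouredEdge → ColouredEdge
  embed (i , j , c) = ι i , ι j , c

  state : State → State
  state L = map embed L ++ S₀

  lift : ∀ {L i j c} → HasEdge L i j c → HasEdge (state L) (ι i) (ι j) c
  lift = ⊎-map (∈-++⁺ˡ ∘ ∈-map⁺ embed) (∈-++⁺ˡ ∘ ∈-map⁺ embed)

  keep : ∀ L {x y c} → HasEdge S₀ x y c → HasEdge (state L) x y c
  keep L = ⊎-map (∈-++⁺ʳ (map embed L)) (∈-++⁺ʳ (map embed L))

  HasColour : State → ℕ → ℕ → Colour → Set
  HasColour L i j c = ∃ λ w → HasEdge (state L) (ι i) w c × w ≢ ι i × w ≢ ι j

  -- An old neighbour lies below `N` and hence differs from a fresh `ι j`. For the labels 0 and 1 it
  -- could be the opposite end, a case that the last hypothesis excludes.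
  old : ∀ L {i j c} → Meets S₀ (ι i) c → 2 ≤ j ⊎ i ≡ j → HasColour L i j c
  old L (w , e , w≢) (inj₁ 2≤j) =
    w , keep L e , w≢ , <⇒≢ (<-≤-trans (S₀<N (HasEdge-sym e)) (N≤ι 2≤j))
  old L (w , e , w≢) (inj₂ refl) = w , keep L e , w≢ , w≢

  coloured : ∀ L {i j c} → 2 ≤ i ⊎ 2 ≤ j ⊎ i ≡ j → Coloured L i j c → HasColour L i j c
  coloured L (inj₁ ()) (inj₁ (inj₁ (refl , _)))
  coloured L (inj₂ far) (inj₁ (inj₁ (refl , c∈))) = old L (All.lookup u-meets c∈) far
  coloured L (inj₁ (s≤s ())) (inj₁ (inj₂ (refl , _)))
  coloured L (inj₂ far) (inj₁ (inj₂ (refl , c∈))) = old L (All.lookup v-meets c∈) far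
  coloured (_ ∷ L) _ (inj₂ (here (refl , inj₁ (refl , y≢i , y≢j)))) =
    _ , inj₁ (here refl) , y≢i ∘ ι-injective , y≢j ∘ ι-injective
  coloured (_ ∷ L) _ (inj₂ (here (refl , inj₂ (refl , x≢i , x≢j)))) =
    _ , inj₂ (here refl) , x≢i ∘ ι-injective , x≢j ∘ ι-injective
  coloured (_ ∷ L) apart (inj₂ (there t)) with coloured L apart (inj₂ t)
  ... | w , e , w≢ = w , ⊎-map there there e , w≢

  meets : ∀ L {i cs} → All (Coloured L i i) cs → All (Meets (state L) (ι i)) cs
  meets L = All.map λ k → let (w , e , w≢ , _) = coloured L (inj₂ (inj₂ refl)) k in w , e , w≢

  clash : ∀ L {i j c} → i ≢ j → 2 ≤ i ⊎ 2 ≤ j → Clash L i j c →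
          HasMonoCopy (state ((i , j , c) ∷ L)) c (Path 3)
  clash L i≢j far (inj₁ k) with coloured L (⊎-map id inj₁ far) k
  ... | w , e , w≢i , w≢j =
    path₃ (⊎-map there there (HasEdge-sym e)) (inj₁ (here refl)) w≢i (i≢j ∘ ι-injective) w≢j
  clash L i≢j far (inj₂ k) with coloured L ([ inj₂ ∘ inj₁ , inj₁ ]′ far) k
  ... | w , e , w≢j , w≢i =
    path₃ (⊎-map there there (HasEdge-sym e)) (inj₂ (here refl)) w≢j
      (i≢j ∘ sym ∘ ι-injective) w≢i

  apart₀ : ∀ {i j c} → 2 ≤ i ⊎ 2 ≤ j → ¬ HasEdge S₀ (ι i) (ι j) c
  apart₀ (inj₁ 2≤i) e = <⇒≱ (S₀<N e) (N≤ι 2≤i)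
  apart₀ (inj₂ 2≤j) e = <⇒≱ (S₀<N (HasEdge-sym e)) (N≤ι 2≤j)

  apart : ∀ L {i j c} → 2 ≤ i ⊎ 2 ≤ j → All (Avoids i j) L →
          ¬ HasEdge (state L) (ι i) (ι j) c
  apart [] far [] e = apart₀ far e
  apart ((x , y , _) ∷ L) far (a ∷ as) (inj₁ (here e)) =
    proj₁ a (sym (ι-injective (cong proj₁ e)) , sym (ι-injective (cong (proj₁ ∘ proj₂) e)))
  apart ((x , y , _) ∷ L) far (a ∷ as) (inj₂ (here e)) =
    proj₂ a (sym (ι-injective (cong proj₁ e)) , sym (ι-injective (cong (proj₁ ∘ proj₂) e)))
  apart (_ ∷ L) far (a ∷ as) (inj₁ (there e)) = apart L far as (inj₁ e)
  apart (_ ∷ L) far (a ∷ as) (inj₂ (there e)) = apart L far as (inj₂ e)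

  Unused : List ℕ → List Vertex → Set
  Unused us vs = ∀ {x} → 2 ≤ x → x ∉ us → ι x ∉ vs

  extend : ∀ L {i us w vs} xs → Extends L i us xs → Unused us vs →
           GreenPath (state L) (ι i) w vs →
           ∃ λ vs′ → GreenPath (state L) (ι (end i xs)) w vs′ ×
             length vs′ ≡ length xs + length vs × Unused (mark us xs) vs′
  extend L [] _ free path = _ , path , refl , free
  extend L {i} {us} {w} {vs} (x ∷ xs) (e , 2≤x , x∉ , ext) free path
    with extend L xs ext free′ (left (HasEdge-sym (lift e)) (free 2≤x x∉) path)
    where
    free′ : Unused (x ∷ us) (ι x ∷ vs)
    free′ 2≤y y∉ (here eq) = y∉ (here (ι-injective eq))
    free′ 2≤y y∉ (there y∈) = free 2≤y (y∉ ∘ there) y∈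
  ... | vs′ , path′ , len , free″ = vs′ , path′ , trans len (+-suc (length xs) (length vs)) , free″

  extend₂ : ∀ L xs ys → Extends₂ L xs ys →
            ∃ λ vs → GreenPath (state L) (ι (end p xs)) (ι (end q ys)) vs ×
              length vs ≡ (length xs + length ys) + length vs₀
  extend₂ L xs ys (extˡ , extʳ)
    with extend L xs extˡ unused (weaken (keep L) path₀)
  -- The far end is extended by the same lemma, applied to the reversed path; the labels marked so
  -- far keep the two extensions disjoint.
  ... | vs , path , len , free with extend L ys extʳ free (flip path)
  ... | vs′ , path′ , len′ , _ = vs′ , flip path′ ,
    trans len′ (trans (cong (length ys +_) len)
      (trans (sym (+-assoc (length ys) (length xs) (length vs₀)))
        (cong (_+ length vs₀) (+-comm (length ys) (length xs)))))

  covers : ∀ {a m′ n} → n ≡ a + length vs₀ → m ≡ a + m′ → n + m′ ≡ ℓ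
  covers {a} {m′} refl refl = trans
    (cong (_+ m′) (+-comm a (length vs₀))) (trans (+-assoc (length vs₀) a m′) covers₀)

  module _ (d : ℕ) (reach : ∀ {o a f} → Accept o a f → Reaches ℓ m o a (f + d)) where

    -- Validity is evaluated for a numeral `f`; the surplus `d`, which depends on the length of the
    -- cycle, is carried along and is still available in the positions reached.
    follow : ∀ t f L → Valid t f L → Win ℓ (f + d) (state L)
    follow (draw i j r b g) (suc f) L ((i≢j , far , new) , vr , vb , vg) =
      move (ι i) (ι j) (i≢j ∘ ι-injective) (λ (c , e) → apart L far new e) λ where
        red → [ done ∘ inj₁ ∘ clash L i≢j far , follow r f _ ]′ vr
        blue → [ done ∘ inj₂ ∘ inj₁ ∘ clash L i≢j far , follow b f _ ]′ vb
        green → follow g f _ vg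
    follow (closed xs ys) f L (ext , e , acc) with extend₂ L xs ys ext
    ... | vs , path , len =
      done (inj₂ (inj₂ (subst (λ n → HasMonoCopy (state L) green (Cycle n)) full-length
        (close-up path (lift e)))))
      where
      full-length : length vs ≡ ℓ
      full-length = trans (sym (+-identityʳ (length vs)))
        (covers len (sym (trans (+-identityʳ _) (reach acc))))
    follow (reached K xs ys) f L (ext , (i≢j , cs , ds) , acc)
      with extend₂ L xs ys ext | reach acc
    ... | vs , path , len | m′ , eq , wins = wins record
      { path = path ; u≢v = i≢j ∘ ι-injective ; near-end = meets L cs ; far-end = meets L ds
      ; covers = covers len eq }
    follow (turned K xs ys) f L (ext , (i≢j , cs , ds) , acc)
      with extend₂ L xs ys ext | reach acc
    ... | vs , path , len | m′ , eq , wins = wins record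
      { path = flip path ; u≢v = i≢j ∘ ι-injective ; near-end = meets L cs ; far-end = meets L ds
      ; covers = covers len eq }

-- The gadgets as explicit trees

-- The trees for `ready` assume red at the near end, those for `half` blue at the
-- far end; `swap` gives the others.

ready₁ : Tree
ready₁ = draw 0 2
    barred
    (forced 0 3 (forced 1 3 (closed (3 ∷ []) [])))
    (forced 1 2 (closed (2 ∷ []) []))

ready₂₃ : Tree
ready₂₃ = draw 0 2
    barred
    (forced 1 2 (turned (ready B) [] (2 ∷ [])))
    (reached full (2 ∷ []) [])

ready₄ : Tree
ready₄ = draw 0 2
    barred
    (forced 0 3 (draw 2 3
       (forced 1 4 (forced 2 4 (reached (ready R) (3 ∷ []) (4 ∷ 2 ∷ []))))
       barred
       (reached (ready B) (3 ∷ 2 ∷ []) [])))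
    (draw 2 3
       (forced 1 3 (draw 2 4
          barred
          (forced 3 4 (turned (ready B) (2 ∷ []) (3 ∷ 4 ∷ [])))
          (draw 3 4
             barred
             (reached (ready B) (2 ∷ 4 ∷ []) (3 ∷ []))
             (reached (ready R) (2 ∷ 4 ∷ 3 ∷ []) []))))
       (forced 1 3 (draw 2 4
          (forced 3 4 (turned (ready R) (2 ∷ []) (3 ∷ 4 ∷ [])))
          barred
          (draw 3 4
             (reached (ready R) (2 ∷ 4 ∷ []) (3 ∷ []))
             barred
             (reached (ready B) (2 ∷ 4 ∷ 3 ∷ []) []))))
       (reached full (2 ∷ 3 ∷ []) []))

-- Builder starts among new vertices: a red or blue edge there colours two of them at once, which
-- forces later green edges. Every leaf adds three vertices within four rounds or four within six.
readyStep : Tree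
readyStep = draw 2 3
    (draw 2 4
       barred
       (forced 0 4 (forced 1 5 (forced 2 5 (forced 3 4 (reached (ready R) (4 ∷ 3 ∷ []) (5 ∷ 2 ∷ []))))))
       (draw 3 4
          barred
          (forced 0 4 (forced 1 5 (forced 3 5 (reached (ready R) (4 ∷ 2 ∷ []) (5 ∷ 3 ∷ [])))))
          (draw 0 2
             barred
             (forced 0 5 (forced 2 5 (reached (ready R) (5 ∷ 2 ∷ 4 ∷ 3 ∷ []) [])))
             (reached (ready R) (2 ∷ 4 ∷ 3 ∷ []) []))))
    (draw 2 4
       (forced 0 3 (forced 1 5 (forced 2 5 (forced 3 4 (reached (ready R) (3 ∷ 4 ∷ []) (5 ∷ 2 ∷ []))))))
       barred
       (forced 0 2 (draw 3 4
          (forced 1 5 (forced 3 5 (reached (ready R) (2 ∷ 4 ∷ []) (5 ∷ 3 ∷ []))))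
          barred
          (reached (ready B) (2 ∷ 4 ∷ 3 ∷ []) []))))
    (draw 2 4
       (draw 3 4
          barred
          (forced 0 3 (forced 1 5 (forced 4 5 (reached (ready R) (3 ∷ 2 ∷ []) (5 ∷ 4 ∷ [])))))
          (draw 0 2
             barred
             (forced 0 5 (forced 2 5 (reached (ready R) (5 ∷ 2 ∷ 3 ∷ 4 ∷ []) [])))
             (reached (ready R) (2 ∷ 3 ∷ 4 ∷ []) [])))
       (forced 0 2 (draw 3 4
          (forced 1 5 (forced 4 5 (reached (ready R) (2 ∷ 3 ∷ []) (5 ∷ 4 ∷ []))))
          barred
          (reached (ready B) (2 ∷ 3 ∷ 4 ∷ []) [])))
       (draw 0 3
          barred
          (forced 0 4 (reached (ready B) (4 ∷ 2 ∷ 3 ∷ []) []))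
          (reached full (3 ∷ 2 ∷ 4 ∷ []) [])))

full₁ : Tree
full₁ = draw 0 2
    (reached (ready R) [] [])
    (reached (ready B) [] [])
    (forced 1 2 (closed (2 ∷ []) []))

half₁ : Tree
half₁ = draw 1 2
    (reached full [] [])
    barred
    (draw 0 3
       (draw 0 2
          barred
          (turned (ready B) [] [])
          (closed (2 ∷ []) []))
       (draw 0 2
          (turned (ready B) [] [])
          barred
          (closed (2 ∷ []) []))
       (draw 1 3
          (reached full [] [])
          barred
          (closed (3 ∷ []) [])))

half₂ : Tree
half₂ = draw 0 2
    (forced 1 2 (draw 0 3
       barred
       (turned (ready R) [] (2 ∷ []))
       (draw 2 3
          barred
          (reached (ready R) [] (2 ∷ []))
          (closed (3 ∷ 2 ∷ []) []))))
    (draw 0 3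
       (turned (ready B) [] [])
       barred
       (draw 1 2
          (reached full (3 ∷ []) [])
          barred
          (draw 2 3
             (reached (ready B) [] (2 ∷ []))
             barred
             (closed (3 ∷ 2 ∷ []) []))))
    (reached (half B) (2 ∷ []) [])

half₃ : Tree
half₃ = draw 0 2
    (draw 0 3
       barred
       (turned (ready B) [] [])
       (draw 1 4
          (reached full (3 ∷ []) [])
          barred
          (draw 2 3
             barred
             (forced 1 2 (reached (ready B) (3 ∷ []) (2 ∷ [])))
             (draw 2 4
                barred
                (turned (ready B) (3 ∷ 2 ∷ []) [])
                (closed (3 ∷ 2 ∷ 4 ∷ []) [])))))
    (draw 0 3
       (turned (ready B) [] [])
       barred
       (draw 1 4
          (reached full (3 ∷ []) [])
          barred
          (draw 2 3
             (forced 1 2 (reached (ready R) (3 ∷ []) (2 ∷ [])))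
             barred
             (draw 2 4
                (turned (ready B) (3 ∷ 2 ∷ []) [])
                barred
                (closed (3 ∷ 2 ∷ 4 ∷ []) [])))))
    (reached (half B) (2 ∷ []) [])

-- Every leaf adds three vertices: within five rounds when `ready` is reached, within four when
-- Painter holds the position at `half`.
halfStep : Tree
halfStep = draw 2 3
    (draw 2 4
       barred
       (forced 0 2 (forced 1 3 (forced 3 4 (turned (ready B) (2 ∷ []) (3 ∷ 4 ∷ [])))))
       (forced 1 2 (draw 0 3
          barred
          (forced 3 4 (reached (ready B) [] (2 ∷ 4 ∷ 3 ∷ [])))
          (turned (half R) (3 ∷ []) (2 ∷ 4 ∷ [])))))
    (draw 2 4
       (forced 0 2 (forced 1 4 (forced 3 4 (turned (ready B) (2 ∷ []) (4 ∷ 3 ∷ [])))))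
       barred
       (draw 0 3
          (forced 0 2 (forced 3 4 (turned (ready B) (2 ∷ 4 ∷ 3 ∷ []) [])))
          barred
          (draw 1 2
             (forced 1 4 (reached (ready B) (3 ∷ []) (4 ∷ 2 ∷ [])))
             barred
             (turned (half B) (3 ∷ []) (2 ∷ 4 ∷ [])))))
    (draw 2 4
       (forced 1 2 (draw 0 4
          barred
          (forced 3 4 (reached (ready B) [] (2 ∷ 3 ∷ 4 ∷ [])))
          (turned (half R) (4 ∷ []) (2 ∷ 3 ∷ []))))
       (draw 0 4
          (forced 0 2 (forced 3 4 (turned (ready B) (2 ∷ 3 ∷ 4 ∷ []) [])))
          barred
          (draw 1 2
             (forced 1 3 (reached (ready B) (4 ∷ []) (3 ∷ 2 ∷ [])))
             barred
             (turned (half B) (4 ∷ []) (2 ∷ 3 ∷ []))))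
       (draw 1 3
          (forced 1 4 (reached (half R) [] (4 ∷ 2 ∷ 3 ∷ [])))
          barred
          (draw 0 4
             (reached (half R) [] (3 ∷ 2 ∷ 4 ∷ []))
             (reached (half B) [] (3 ∷ 2 ∷ 4 ∷ []))
             (reached (half B) (4 ∷ 2 ∷ 3 ∷ []) []))))

bare₁ : Tree
bare₁ = draw 0 2
    (turned (half R) [] [])
    (turned (half B) [] [])
    (draw 1 2
       (reached (half R) [] [])
       (reached (half B) [] [])
       (closed (2 ∷ []) []))

fullStep : Tree
fullStep = draw 0 2
    (reached (ready R) [] [])
    (reached (ready B) [] [])
    (reached full (2 ∷ []) [])

bareStep : Tree
bareStep = draw 0 2
    (turned (half R) [] [])
    (turned (half B) [] [])
    (reached bare (2 ∷ []) [])

-- Up to exchange of colours: after a red and a blue edge at the first vertex 2, the edges 3 4 and 2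
-- 5 are forced green. A blue edge 3 6 then leads to `ready` with three vertices added; a green one
-- leads only to `half`, but with four.
opening : Tree
opening = draw 3 2 after-red (swap after-red) (reached bare (3 ∷ []) [])
  where
  after-red : Tree
  after-red = draw 2 4
    barred
    (forced 3 4 (forced 2 5 (draw 3 6
       barred
       (forced 3 5 (turned (ready B) [] (5 ∷ 3 ∷ 4 ∷ [])))
       (forced 2 6 (turned (half B) (6 ∷ 3 ∷ 4 ∷ []) (5 ∷ []))))))
    (turned (half R) [] (4 ∷ []))

-- Sufficient numbers of rounds

-- A red or blue reply at the near end turns `bare` into `half` and `full` into
-- `ready` at the cost of one round, so these inequalities differ by 2 or 3
-- accordingly.  In `ready`, the case m = 3, f = 6 is lost; the residue modulo 4
-- admits the tight positions from which it is not reached.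
Good : Kind → ℕ → ℕ → Set
Good bare m f = (7 + 3 * m ≤ 2 * f × 18 + 4 * m ≤ 3 * f) × 11 + m ≤ f
Good full m f = 6 + 3 * m ≤ 2 * f ⊎ (m % 4 ≡ 1 × 5 + 3 * m ≤ 2 * f)
Good (half _) m f = 5 + 3 * m ≤ 2 * f × 15 + 4 * m ≤ 3 * f
Good (ready _) m f = 4 + 3 * m ≤ 2 * f ⊎ (m % 4 ≡ 1 × 3 + 3 * m ≤ 2 * f)

good? : ∀ K m f → Dec (Good K m f)
good? bare m f = ((_ ≤? _) ×-dec (_ ≤? _)) ×-dec (_ ≤? _)
good? full m f = (_ ≤? _) ⊎-dec ((_ ≟ _) ×-dec (_ ≤? _))
good? (half _) m f = (_ ≤? _) ×-dec (_ ≤? _)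
good? (ready _) m f = (_ ≤? _) ⊎-dec ((_ ≟ _) ×-dec (_ ≤? _))

more : ∀ t {n} f d → n ≤ t * f → n ≤ t * (f + d)
more t f d n≤ = ≤-trans n≤ (*-monoʳ-≤ t (m≤m+n f d))

good-mono : ∀ K {m} f d → Good K m f → Good K m (f + d)
good-mono bare f d ((x , y) , z) = (more 2 f d x , more 3 f d y) , ≤-trans z (m≤m+n f d)
good-mono full f d = ⊎-map (more 2 f d) λ (r , x) → r , more 2 f d x
good-mono (half _) f d (x , y) = more 2 f d x , more 3 f d y
good-mono (ready _) f d = ⊎-map (more 2 f d) λ (r , x) → r , more 2 f d x

rank : Kind → ℕ
rank (ready _) = 0
rank full = 1
rank (half _) = 2
rank bare = 3

rank<4 : ∀ K → rank K < 4
rank<4 (ready _) = s≤s z≤n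
rank<4 full = s≤s (s≤s z≤n)
rank<4 (half _) = s≤s (s≤s (s≤s z≤n))
rank<4 bare = ≤-refl

-- The lexicographic order on `m` and `rank K` in one number, as ranks stay below 4. The rank
-- accounts for replies that improve the ends without adding a vertex.
μ : Kind → ℕ → ℕ
μ K m = rank K + 4 * m

μ-drop : ∀ K′ K {m′ m} → m′ < m → μ K′ m′ < μ K m
μ-drop K′ K {m′} {m} m′<m = begin-strict
  rank K′ + 4 * m′ <⟨ +-monoˡ-< (4 * m′) (rank<4 K′) ⟩
  4 + 4 * m′       ≡⟨ *-suc 4 m′ ⟨
  4 * suc m′       ≤⟨ *-monoʳ-≤ 4 m′<m ⟩
  4 * m            ≤⟨ m≤n+m (4 * m) (rank K) ⟩
  rank K + 4 * m   ∎
  where open ≤-Reasoning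

module Rounds where
  open +-*-Solver

  -- The effect of adding a vertices within r ∸ f rounds on the inequalities in
  -- `Good`, stated without subtraction.
  carry : ∀ s t {p q a m r f d} → p + s * (a + m) ≤ t * (r + d) →
          q + t * r ≤ p + s * a + t * f → q + s * m ≤ t * (f + d)
  carry s t {p} {q} {a} {m} {r} {f} {d} before spent =
    +-cancelʳ-≤ (p + s * a + t * r) _ _ (subst₂ _≤_
      (solve 7 (λ s t p q a m r → (p :+ s :* (a :+ m)) :+ (q :+ t :* r)
        := (q :+ s :* m) :+ (p :+ s :* a :+ t :* r)) refl s t p q a m r)
      (solve 7 (λ s t p a r f d → t :* (r :+ d) :+ (p :+ s :* a :+ t :* f)
        := t :* (f :+ d) :+ (p :+ s :* a :+ t :* r)) refl s t p a r f d)
      (+-mono-≤ before spent))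

  -- The condition on slopes, four vertices per six rounds, reduces a family of inequalities to its
  -- case i = 0.
  affine : ∀ s t {p x y} i → p + s * x ≤ t * y → s * 4 ≤ t * 6 →
           p + s * (x + 4 * i) ≤ t * (y + 6 * i)
  affine s t {p} {x} {y} i const slope = subst₂ _≤_
    (solve 4 (λ s p x i → (p :+ s :* x) :+ s :* con 4 :* i := p :+ s :* (x :+ con 4 :* i))
      refl s p x i)
    (solve 3 (λ t y i → t :* y :+ t :* con 6 :* i := t :* (y :+ con 6 :* i)) refl t y i)
    (+-mono-≤ const (*-monoˡ-≤ i slope))

open Rounds

≤! : ∀ {m n} {p : True (m ≤? n)} → m ≤ n
≤! {p = p} = toWitness p

at-least : ∀ t {r n f} → n ≤ t * f → {p : True (t * r <? n)} → r < f
at-least t {r} {f = f} n≤ {p = p} = *-cancelˡ-< t r f (<-≤-trans (toWitness p) n≤)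

-- The strategy

-- Here `m` is a numeral, so that the decrease of `μ` and the bound `Good` are decided by
-- evaluation. The growth rules below serve a variable `m` and therefore speak only of `a` and `f`.
AcceptBase : Kind → ℕ → Outcome → ℕ → ℕ → Set
AcceptBase K m cycle a f = a ≡ m
AcceptBase K m (position K′) a f = a < m × μ K′ (m ∸ a) < μ K m × Good K′ (m ∸ a) f

acceptBase? : ∀ K m o a f → Dec (AcceptBase K m o a f)
acceptBase? K m cycle a f = a ≟ m
acceptBase? K m (position K′) a f = (a <? m) ×-dec ((_ <? _) ×-dec good? K′ (m ∸ a) f)

baseRule : Kind → ℕ → Rule
baseRule K m = record { Accept = AcceptBase K m ; accept? = acceptBase? K m }

-- The bounds are those of `carry` for r = 6: starting from the weaker constant 3, 16 = 4 + 2 * 6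
-- secures the constant 4 of `ready`, and 18 = 6 + 2 * 6 the constant 6 of `full`. For a = 4 the
-- residue modulo 4 persists, so each alternative of `Good` passes to its counterpart.
AcceptReady : Outcome → ℕ → ℕ → Set
AcceptReady (position (ready _)) a f = (1 ≤ a × a ≤ 4) × (16 ≤ 3 + 3 * a + 2 * f ⊎ a ≡ 4)
AcceptReady (position full) a f =
  (1 ≤ a × a ≤ 4) × (18 ≤ 3 + 3 * a + 2 * f ⊎ (a ≡ 4 × 1 ≤ f))
AcceptReady _ a f = ⊥

acceptReady? : ∀ o a f → Dec (AcceptReady o a f)
acceptReady? (position (ready _)) a f = ((_ ≤? _) ×-dec (_ ≤? _)) ×-dec ((_ ≤? _) ⊎-dec (_ ≟ _))
acceptReady? (position full) a f =
  ((_ ≤? _) ×-dec (_ ≤? _)) ×-dec ((_ ≤? _) ⊎-dec ((_ ≟ _) ×-dec (_ ≤? _)))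
acceptReady? cycle a f = no λ ()
acceptReady? (position bare) a f = no λ ()
acceptReady? (position (half _)) a f = no λ ()

readyRule : Rule
readyRule = record { Accept = AcceptReady ; accept? = acceptReady? }

-- From `carry` for r = 5: 14 = 4 + 2 * 5, 15 = 5 + 2 * 5 and 30 = 15 + 3 * 5. Three vertices in
-- four rounds leave f = 1 and meet the last bound with equality, while gaining one in the bound
-- before it.
AcceptHalf : Outcome → ℕ → ℕ → Set
AcceptHalf (position (ready _)) a f = a ≤ 3 × 14 ≤ 5 + 3 * a + 2 * f
AcceptHalf (position (half _)) a f =
  a ≤ 3 × 1 ≤ a × 15 ≤ 5 + 3 * a + 2 * f × 30 ≤ 15 + 4 * a + 3 * f
AcceptHalf _ a f = ⊥

acceptHalf? : ∀ o a f → Dec (AcceptHalf o a f)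
acceptHalf? (position (ready _)) a f = (_ ≤? _) ×-dec (_ ≤? _)
acceptHalf? (position (half _)) a f =
  (_ ≤? _) ×-dec ((_ ≤? _) ×-dec ((_ ≤? _) ×-dec (_ ≤? _)))
acceptHalf? cycle a f = no λ ()
acceptHalf? (position bare) a f = no λ ()
acceptHalf? (position full) a f = no λ ()

halfRule : Rule
halfRule = record { Accept = AcceptHalf ; accept? = acceptHalf? }

AcceptFull : Outcome → ℕ → ℕ → Set
AcceptFull (position (ready _)) a f = a ≡ 0
AcceptFull (position full) a f = a ≡ 1
AcceptFull _ a f = ⊥

acceptFull? : ∀ o a f → Dec (AcceptFull o a f)
acceptFull? (position (ready _)) a f = a ≟ 0
acceptFull? (position full) a f = a ≟ 1
acceptFull? cycle a f = no λ ()
acceptFull? (position bare) a f = no λ ()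
acceptFull? (position (half _)) a f = no λ ()

fullRule : Rule
fullRule = record { Accept = AcceptFull ; accept? = acceptFull? }

AcceptBare : Outcome → ℕ → ℕ → Set
AcceptBare (position (half _)) a f = a ≡ 0
AcceptBare (position bare) a f = a ≡ 1
AcceptBare _ a f = ⊥

acceptBare? : ∀ o a f → Dec (AcceptBare o a f)
acceptBare? (position (half _)) a f = a ≟ 0
acceptBare? (position bare) a f = a ≟ 1
acceptBare? cycle a f = no λ ()
acceptBare? (position full) a f = no λ ()
acceptBare? (position (ready _)) a f = no λ ()

bareRule : Rule
bareRule = record { Accept = AcceptBare ; accept? = acceptBare? }

frame : Kind → Rule → Frame
frame K ρ = record { As = near K ; Bs = far K ; p = 0 ; q = 1 ; used = [] ; rule = ρ }

Sound : Kind → Rule → ℕ → Tree → Set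
Sound K ρ r t = True (Validity.valid? (frame K ρ) t r [])

play : ∀ {ℓ K m} ρ r t → Sound K ρ r t →
       ∀ d → (∀ {o a f} → Rule.Accept ρ o a f → Reaches ℓ m o a (f + d)) → Wins ℓ K m (r + d)
play {ℓ} {K} ρ r t sound d reach {S} P with bound (endpoints S ++ Position.vs P)
... | N , <N =
  Soundness.follow ℓ (frame K ρ) board path unused covers d reach t r [] (toWitness sound)
  where
  open Position P

  board : Board S (near K) (far K)
  board = record
    { u≢v = u≢v
    ; u<N = All.lookup <N (∈-++⁺ʳ (endpoints S) (start∈ path))
    ; v<N = All.lookup <N (∈-++⁺ʳ (endpoints S) (end∈ path))
    ; S₀<N = [ (λ e → All.lookup <N (∈-++⁺ˡ (proj₁ (endpoints∈ e))))
             , (λ e → All.lookup <N (∈-++⁺ˡ (proj₂ (endpoints∈ e)))) ]′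
    ; u-meets = near-end
    ; v-meets = far-end }

  unused : ∀ {x} → 2 ≤ x → x ∉ [] → Board.ι board x ∉ vs
  unused 2≤x _ x∈ =
    <⇒≱ (All.lookup <N (∈-++⁺ʳ (endpoints S) x∈)) (Board.N≤ι board 2≤x)

[4+m]%4 : ∀ m → (4 + m) % 4 ≡ m % 4
[4+m]%4 m = trans (cong (_% 4) (+-comm 4 m)) ([m+n]%n≡m%n m 4)

-- The induction over positions

module Induction (ℓ : ℕ) where

  Below : Kind → ℕ → Set
  Below K m = ∀ K′ m′ f → μ K′ m′ < μ K m → 1 ≤ m′ → Good K′ m′ f → Wins ℓ K′ m′ f

  descend : ∀ K {m K′ a f} → Below K m → a < m →
            (∀ m′ → m ≡ a + m′ → μ K′ m′ < μ K m × Good K′ m′ f) →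
            Reaches ℓ m (position K′) a f
  descend K {m} {a = a} below a<m ok with ok (m ∸ a) (sym (m+[n∸m]≡n (<⇒≤ a<m)))
  ... | less , good =
    m ∸ a , sym (m+[n∸m]≡n (<⇒≤ a<m)) , below _ _ _ less (m<n⇒0<n∸m a<m) good

  shorter : ∀ K′ K {a m m′} → 1 ≤ a → m ≡ a + m′ → μ K′ m′ < μ K m
  shorter K′ K {m′ = m′} 1≤a refl = μ-drop K′ K (+-monoˡ-≤ m′ 1≤a)

  base : ∀ K m r t → Sound K (baseRule K m) r t → Below K m → ∀ {f} → r ≤ f → Wins ℓ K m f
  base K m r t sound below {f} r≤f = subst (λ n → Wins ℓ K m n) (m+[n∸m]≡n r≤f)
    (play (baseRule K m) r t sound (f ∸ r) reach)
    where
    reach : ∀ {o a g} → AcceptBase K m o a g → Reaches ℓ m o a (g + (f ∸ r))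
    reach {cycle} a≡m = a≡m
    reach {position K′} {a} {g} (a<m , less , good) =
      m ∸ a , sym (m+[n∸m]≡n (<⇒≤ a<m)) ,
      below K′ _ _ less (m<n⇒0<n∸m a<m) (good-mono K′ g (f ∸ r) good)

  advance : ∀ K m ρ r t → Sound K ρ r t → ∀ {f} → r ≤ f → Good K m f →
            (∀ d → Good K m (r + d) →
              ∀ {o a g} → Rule.Accept ρ o a g → Reaches ℓ m o a (g + d)) →
            Wins ℓ K m f
  advance K m ρ r t sound {f} r≤f good reach = subst (λ n → Wins ℓ K m n) r+d≡f
    (play ρ r t sound (f ∸ r) (reach (f ∸ r) (subst (Good K m) (sym r+d≡f) good)))
    where
    r+d≡f : r + (f ∸ r) ≡ f
    r+d≡f = m+[n∸m]≡n r≤f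

  slack : ∀ h m f → Good (ready h) m f → 3 + 3 * m ≤ 2 * f
  slack h m f (inj₁ x) = <⇒≤ x
  slack h m f (inj₂ (_ , x)) = x

  many : ∀ h i f → Good (ready h) (5 + i) f → 6 ≤ f
  many h i f g = at-least 2 {5} {18}
    (≤-trans (+-monoʳ-≤ 3 (*-monoʳ-≤ 3 (m≤m+n 5 i))) (slack h (5 + i) f g))

  reachReady : ∀ {h i} → Below (ready h) (5 + i) → ∀ d → Good (ready h) (5 + i) (6 + d) →
               ∀ {o a f} → AcceptReady o a f → Reaches ℓ (5 + i) o a (f + d)
  reachReady {h} {i} below d good {position (ready h′)} {a} {f} ((1≤a , a≤4) , acc) =
    descend (ready h) below (≤-trans (s≤s a≤4) (m≤m+n 5 i)) λ m′ eq →
      shorter (ready h′) (ready h) 1≤a eq , gain m′ (subst (λ m → Good (ready h) m (6 + d)) eq good) acc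
    where
    gain : ∀ m′ → Good (ready h) (a + m′) (6 + d) → 16 ≤ 3 + 3 * a + 2 * f ⊎ a ≡ 4 →
           Good (ready h′) m′ (f + d)
    gain m′ g (inj₁ x) = inj₁ (carry 3 2 {3} {4} {a} {m′} {6} {f} (slack h (a + m′) (6 + d) g) x)
    gain m′ (inj₁ g) (inj₂ refl) = inj₁ (carry 3 2 {4} {4} {4} {m′} {6} {f} g (m≤m+n 16 (2 * f)))
    gain m′ (inj₂ (r , g)) (inj₂ refl) =
      inj₂ (trans (sym ([4+m]%4 m′)) r , carry 3 2 {3} {3} {4} {m′} {6} {f} g (m≤m+n 15 (2 * f)))
  reachReady {h} {i} below d good {position full} {a} {f} ((1≤a , a≤4) , acc) =
    descend (ready h) below (≤-trans (s≤s a≤4) (m≤m+n 5 i)) λ m′ eq →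
      shorter full (ready h) 1≤a eq , gain m′ (subst (λ m → Good (ready h) m (6 + d)) eq good) acc
    where
    gain : ∀ m′ → Good (ready h) (a + m′) (6 + d) → 18 ≤ 3 + 3 * a + 2 * f ⊎ (a ≡ 4 × 1 ≤ f) →
           Good full m′ (f + d)
    gain m′ g (inj₁ x) = inj₁ (carry 3 2 {3} {6} {a} {m′} {6} {f} (slack h (a + m′) (6 + d) g) x)
    gain m′ (inj₁ g) (inj₂ (refl , 1≤f)) =
      inj₁ (carry 3 2 {4} {6} {4} {m′} {6} {f} g (+-monoʳ-≤ 16 (*-monoʳ-≤ 2 1≤f)))
    gain m′ (inj₂ (r , g)) (inj₂ (refl , 1≤f)) =
      inj₂ (trans (sym ([4+m]%4 m′)) r ,
            carry 3 2 {3} {5} {4} {m′} {6} {f} g (+-monoʳ-≤ 15 (*-monoʳ-≤ 2 1≤f)))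

  reachHalf : ∀ {h i} → Below (half h) (4 + i) → ∀ d → Good (half h) (4 + i) (5 + d) →
              ∀ {o a f} → AcceptHalf o a f → Reaches ℓ (4 + i) o a (f + d)
  reachHalf {h} {i} below d good {position (ready h′)} {a} {f} (a≤3 , x) =
    descend (half h) below (≤-trans (s≤s a≤3) (m≤m+n 4 i)) λ m′ eq →
      less m′ eq , inj₁ (carry 3 2 {5} {4} {a} {m′} {5} {f}
        (subst (λ m → 5 + 3 * m ≤ 2 * (5 + d)) eq (proj₁ good)) x)
    where
    less : ∀ m′ → 4 + i ≡ a + m′ → μ (ready h′) m′ < μ (half h) (4 + i)
    less m′ eq = s≤s (m≤n⇒m≤1+n (*-monoʳ-≤ 4 (subst (m′ ≤_) (sym eq) (m≤n+m m′ a))))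
  reachHalf {h} {i} below d (g₁ , g₂) {position (half h′)} {a} {f} (a≤3 , 1≤a , x , y) =
    descend (half h) below (≤-trans (s≤s a≤3) (m≤m+n 4 i)) λ m′ eq →
      shorter (half h′) (half h) 1≤a eq ,
      carry 3 2 {5} {5} {a} {m′} {5} {f} (subst (λ m → 5 + 3 * m ≤ 2 * (5 + d)) eq g₁) x ,
      carry 4 3 {15} {15} {a} {m′} {5} {f} (subst (λ m → 15 + 4 * m ≤ 3 * (5 + d)) eq g₂) y

  reachFull : ∀ {i} → Below full (2 + i) → ∀ d → Good full (2 + i) (1 + d) →
              ∀ {o a f} → AcceptFull o a f → Reaches ℓ (2 + i) o a (f + d)
  reachFull {i} below d good {position (ready h)} {f = f} refl =
    2 + i , refl , below (ready h) (2 + i) (f + d) ≤-refl (s≤s z≤n) (gain good)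
    where
    gain : Good full (2 + i) (1 + d) → Good (ready h) (2 + i) (f + d)
    gain (inj₁ x) = inj₁ (carry 3 2 {6} {4} {0} {2 + i} {1} {f} x (m≤m+n 6 (2 * f)))
    gain (inj₂ (r , x)) = inj₂ (r , carry 3 2 {5} {3} {0} {2 + i} {1} {f} x (m≤m+n 5 (2 * f)))
  reachFull {i} below d good {position full} {f = f} refl =
    1 + i , refl , below full (1 + i) (f + d) (μ-drop full full {1 + i} {2 + i} ≤-refl) (s≤s z≤n)
      -- One vertex for one round gains 3 - 2 = 1, which raises the weaker constant 5 to 6 and
      -- removes the residue condition.
      (inj₁ (carry 3 2 {5} {6} {1} {1 + i} {1} {f} ([ <⇒≤ , proj₂ ]′ good) (m≤m+n 8 (2 * f))))

  reachBare : ∀ {i} → Below bare (2 + i) → ∀ d → Good bare (2 + i) (1 + d) →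
              ∀ {o a f} → AcceptBare o a f → Reaches ℓ (2 + i) o a (f + d)
  reachBare {i} below d ((x , y) , _) {position (half h)} {f = f} refl =
    2 + i , refl , below (half h) (2 + i) (f + d) ≤-refl (s≤s z≤n)
      (carry 3 2 {7} {5} {0} {2 + i} {1} {f} x (m≤m+n 7 (2 * f)) ,
       carry 4 3 {18} {15} {0} {2 + i} {1} {f} y (m≤m+n 18 (3 * f)))
  reachBare {i} below d ((x , y) , z) {position bare} {f = f} refl =
    1 + i , refl , below bare (1 + i) (f + d) (μ-drop bare bare {1 + i} {2 + i} ≤-refl) (s≤s z≤n)
      ((carry 3 2 {7} {7} {1} {1 + i} {1} {f} x (≤-trans (≤! {9} {10}) (m≤m+n 10 (2 * f))) ,
        carry 4 3 {18} {18} {1} {1 + i} {1} {f} y (≤-trans (≤! {21} {22}) (m≤m+n 22 (3 * f)))) ,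
       ≤-trans (s≤s⁻¹ z) (m≤n+m d f))

  step : ∀ K m → Below K m → 1 ≤ m → ∀ f → Good K m f → Wins ℓ K m f
  step (ready R) 1 below _ f g = base (ready R) 1 3 ready₁ tt below (at-least 2 (slack R 1 f g))
  step (ready B) 1 below _ f g = base (ready B) 1 3 (swap ready₁) tt below (at-least 2 (slack B 1 f g))
  -- For m = 2, 3, 4 the residue alternative is absurd, so the constant is 4; for m = 3 this rules
  -- out f = 6.
  step (ready R) 2 below _ f (inj₁ g) = base (ready R) 2 5 ready₂₃ tt below (at-least 2 g)
  step (ready B) 2 below _ f (inj₁ g) = base (ready B) 2 5 (swap ready₂₃) tt below (at-least 2 g)
  step (ready R) 3 below _ f (inj₁ g) = base (ready R) 3 7 ready₂₃ tt below (at-least 2 g)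
  step (ready B) 3 below _ f (inj₁ g) = base (ready B) 3 7 (swap ready₂₃) tt below (at-least 2 g)
  step (ready R) 4 below _ f (inj₁ g) = base (ready R) 4 8 ready₄ tt below (at-least 2 g)
  step (ready B) 4 below _ f (inj₁ g) = base (ready B) 4 8 (swap ready₄) tt below (at-least 2 g)
  step (ready R) m@(suc (suc (suc (suc (suc i))))) below _ f g =
    advance (ready R) m readyRule 6 readyStep tt (many R i f g) g (reachReady {R} below)
  step (ready B) m@(suc (suc (suc (suc (suc i))))) below _ f g =
    advance (ready B) m readyRule 6 (swap readyStep) tt (many B i f g) g (reachReady {B} below)
  step full 1 below _ f g = base full 1 4 full₁ tt below (at-least 2 ([ <⇒≤ , proj₂ ]′ g))
  step full m@(suc (suc i)) below _ f g =
    advance full m fullRule 1 fullStep tt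
      (at-least 2 {0} {5} (≤-trans (m≤m+n 5 (3 * m)) ([ <⇒≤ , proj₂ ]′ g))) g (reachFull below)
  step (half R) 1 below _ f (_ , g) = base (half R) 1 7 (swap half₁) tt below (at-least 3 g)
  step (half B) 1 below _ f (_ , g) = base (half B) 1 7 half₁ tt below (at-least 3 g)
  step (half R) 2 below _ f (_ , g) = base (half R) 2 8 (swap half₂) tt below (at-least 3 g)
  step (half B) 2 below _ f (_ , g) = base (half B) 2 8 half₂ tt below (at-least 3 g)
  step (half R) 3 below _ f (_ , g) = base (half R) 3 9 (swap half₃) tt below (at-least 3 g)
  step (half B) 3 below _ f (_ , g) = base (half B) 3 9 half₃ tt below (at-least 3 g)
  step (half R) m@(suc (suc (suc (suc i)))) below _ f g =
    advance (half R) m halfRule 5 (swap halfStep) tt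
      (at-least 3 {4} {15} (≤-trans (m≤m+n 15 (4 * m)) (proj₂ g))) g (reachHalf {R} below)
  step (half B) m@(suc (suc (suc (suc i)))) below _ f g =
    advance (half B) m halfRule 5 halfStep tt
      (at-least 3 {4} {15} (≤-trans (m≤m+n 15 (4 * m)) (proj₂ g))) g (reachHalf {B} below)
  -- A green reply to `bareStep` preserves f - m, so the third inequality still provides twelve
  -- rounds when one vertex is missing.
  step bare 1 below _ f (_ , g) = base bare 1 12 bare₁ tt below g
  step bare m@(suc (suc i)) below _ f g =
    advance bare m bareRule 1 bareStep tt
      (≤-trans (s≤s z≤n) (proj₂ g)) g (reachBare below)

  wins : ∀ K m f → 1 ≤ m → Good K m f → Wins ℓ K m f
  wins K m f 1≤m good = <-rec P rec (μ K m) K m refl 1≤m f good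
    where
    P : ℕ → Set
    P n = ∀ K m → μ K m ≡ n → 1 ≤ m → ∀ f → Good K m f → Wins ℓ K m f

    rec : ∀ n → (∀ {n′} → n′ < n → P n′) → P n
    rec _ ih K m refl = step K m λ K′ m′ f less 1≤m′ → ih less K′ m′ refl 1≤m′ f

-- The opening and the theorem

AcceptOpening : Outcome → ℕ → ℕ → Set
AcceptOpening (position bare) a f = a ≡ 1 × f ≡ 5
AcceptOpening (position (half _)) a f = (a ≡ 1 × f ≡ 4) ⊎ (a ≡ 4 × f ≡ 0)
AcceptOpening (position (ready _)) a f = a ≡ 3 × f ≡ 0
AcceptOpening _ a f = ⊥

acceptOpening? : ∀ o a f → Dec (AcceptOpening o a f)
acceptOpening? (position bare) a f = (_ ≟ _) ×-dec (_ ≟ _)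
acceptOpening? (position (half _)) a f =
  ((_ ≟ _) ×-dec (_ ≟ _)) ⊎-dec ((_ ≟ _) ×-dec (_ ≟ _))
acceptOpening? (position (ready _)) a f = (_ ≟ _) ×-dec (_ ≟ _)
acceptOpening? cycle a f = no λ ()
acceptOpening? (position full) a f = no λ ()

openingRule : Rule
openingRule = record { Accept = AcceptOpening ; accept? = acceptOpening? }

-- The one-vertex path on label 2; the labels 0 and 1 are idle.
openingFrame : Frame
openingFrame = record
  { As = [] ; Bs = [] ; p = 2 ; q = 2 ; used = 2 ∷ [] ; rule = openingRule }

emptyBoard : Board [] [] []
emptyBoard = record
  { u = 0 ; v = 1 ; N = 2 ; u≢v = λ () ; u<N = ≤! ; v<N = ≤!
  ; S₀<N = λ { (inj₁ ()) ; (inj₂ ()) } ; u-meets = [] ; v-meets = [] }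

-- With i = k - 4 there are 16 + 4i missing vertices and 27 + 6i rounds at the start, six of them in
-- the tree. In every `bare` or `half` case the bound comparing 4m with 3f is an equality at i = 0;
-- this is where `k` being at least 4 is used.
reachOpening : ∀ ℓ i {o a f} → AcceptOpening o a f →
               Reaches ℓ (16 + 4 * i) o a (f + (21 + 6 * i))
reachOpening ℓ i {position bare} (refl , refl) =
  15 + 4 * i , refl , Induction.wins ℓ bare (15 + 4 * i) (26 + 6 * i) (s≤s z≤n)
    ((affine 3 2 {7} {15} {26} i ≤! ≤! , affine 4 3 {18} {15} {26} i ≤! ≤!) ,
     +-monoʳ-≤ 26 (*-monoˡ-≤ i {4} {6} ≤!))
reachOpening ℓ i {position (half h)} (inj₁ (refl , refl)) =
  15 + 4 * i , refl , Induction.wins ℓ (half h) (15 + 4 * i) (25 + 6 * i) (s≤s z≤n)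
    (affine 3 2 {5} {15} {25} i ≤! ≤! , affine 4 3 {15} {15} {25} i ≤! ≤!)
reachOpening ℓ i {position (half h)} (inj₂ (refl , refl)) =
  12 + 4 * i , refl , Induction.wins ℓ (half h) (12 + 4 * i) (21 + 6 * i) (s≤s z≤n)
    (affine 3 2 {5} {12} {21} i ≤! ≤! , affine 4 3 {15} {12} {21} i ≤! ≤!)
reachOpening ℓ i {position (ready h)} (refl , refl) =
  13 + 4 * i , refl , Induction.wins ℓ (ready h) (13 + 4 * i) (21 + 6 * i) (s≤s z≤n)
    -- Only the residue alternative applies: 3 + 3 * (13 + 4 * i) equals 2 * (21 + 6 * i) for every
    -- `i`.
    (inj₂ (residue , affine 3 2 {3} {13} {21} i ≤! ≤!))
  where
  residue : (13 + 4 * i) % 4 ≡ 1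
  residue = trans (cong (λ n → (13 + n) % 4) (*-comm 4 i)) ([m+kn]%n≡m%n 13 i 4)

unusedOpening : ∀ {x} → 2 ≤ x → x ∉ 2 ∷ [] → Board.ι emptyBoard x ∉ 2 ∷ []
unusedOpening _ x∉ (here eq) = x∉ (here (Board.ι-injective emptyBoard {j = 2} eq))

theorem4p13 : ∀ (k : ℕ) → 4 ≤ k →
    OnlineRamseyAtMost (Path 3) (Path 3) (Cycle (4 * k + 1)) (6 * k + 3)
theorem4p13 k 4≤k = subst (λ k → Win (4 * k + 1) (6 * k + 3) []) (m+[n∸m]≡n 4≤k) (play-from (k ∸ 4))
  where
  play-from : ∀ i → Win (4 * (4 + i) + 1) (6 * (4 + i) + 3) []
  play-from i = subst (λ b → Win (4 * (4 + i) + 1) b []) rounds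
    (Soundness.follow (4 * (4 + i) + 1) openingFrame emptyBoard (single 2) unusedOpening covers
      (21 + 6 * i) (reachOpening _ i) opening 6 []
      (toWitness {a? = Validity.valid? openingFrame opening 6 []} tt))
    where
    covers : 1 + (16 + 4 * i) ≡ 4 * (4 + i) + 1
    covers = trans (+-comm 1 (16 + 4 * i)) (cong (_+ 1) (sym (*-distribˡ-+ 4 4 i)))

    rounds : 6 + (21 + 6 * i) ≡ 6 * (4 + i) + 3
    rounds = trans (+-comm 3 (24 + 6 * i)) (cong (_+ 3) (sym (*-distribˡ-+ 6 4 i)))
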